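{- Let $k\ge 1$ be an integer, let $G$ be a connected triangle-free graph, and let $v\in V(G)$. If $G$ contains no induced subgraph that is a tree on $k+1$ vertices containing $v$, then $|V(G)\setminus N[v]|\le \frac{(k-2)(k-1)}{2}$.
   Context: All graphs are finite and simple. $N[v]$ denotes the closed neighborhood of $v$, i.e. $v$ together with all its neighbors. -}

module Defs where

open import Data.Nat using (ℕ; zero; suc; _+_)
open import Data.Bool using (Bool; true; false; T; not; _∨_)
open import Data.Fin using (Fin; zero; suc; inject₁; fromℕ; _≟_)
open import Data.Fin.Subset using (Subset; _∈_; ∣_∣)
open import Data.Vec using (tabulate)
open import Data.Product using (Σ; _×_; _,_)
open import Data.Empty using (⊥)
open import Function.Definitions using (Injective)
open import Relation.Binary.PropositionalEquality using (_≡_)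
open import Relation.Nullary.Decidable using (⌊_⌋)

record Graph (n : ℕ) : Set where
  field
    adj   : Fin n → Fin n → Bool
    sym   : ∀ x y → adj x y ≡ adj y x
    loopless : ∀ x → adj x x ≡ false

open Graph public

Adj : ∀ {n} → Graph n → Fin n → Fin n → Set
Adj G x y = T (adj G x y)

data Walk {n : ℕ} (E : Fin n → Fin n → Set) : Fin n → Fin n → Set where
  here : ∀ {x} → Walk E x x
  step : ∀ {x y z} → E x y → Walk E y z → Walk E x z

InducedAdj : ∀ {n} → Graph n → Subset n → Fin n → Fin n → Set
InducedAdj G S x y = x ∈ S × y ∈ S × Adj G x y

InducedConnected : ∀ {n} → Graph n → Subset n → Set
InducedConnected G S = ∀ x y → x ∈ S → y ∈ S → Walk (InducedAdj G S) x y

Connected : ∀ {n} → Graph n → Set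
Connected G = ∀ x y → Walk (Adj G) x y

record InducedCycle {n : ℕ} (G : Graph n) (S : Subset n) : Set where
  field
    m      : ℕ
    c      : Fin (suc (suc (suc m))) → Fin n
    c-inj  : Injective _≡_ _≡_ c
    c-in   : ∀ i → c i ∈ S
    c-path : ∀ (j : Fin (suc (suc m))) → Adj G (c (inject₁ j)) (c (suc j))
    c-close : Adj G (c (fromℕ (suc (suc m)))) (c zero)

InducedAcyclic : ∀ {n} → Graph n → Subset n → Set
InducedAcyclic G S = InducedCycle G S → ⊥

InducedTree : ∀ {n} → Graph n → Subset n → Set
InducedTree G S = InducedConnected G S × InducedAcyclic G S

TriangleFree : ∀ {n} → Graph n → Set
TriangleFree G = ∀ x y z → Adj G x y → Adj G y z → Adj G x z → ⊥

nonNeighbourhood : ∀ {n} → Graph n → Fin n → Subset n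
nonNeighbourhood G v = tabulate (λ u → not (⌊ u ≟ v ⌋ ∨ adj G v u))

{-# OPTIONS --safe #-}
module Submission where

-- Grow trees from v by adding leaves. The neighbours of v are independent; let D run over the
-- components of G - N[v], and let s_D be least with |D| ≤ s_D(s_D+1)/2. By induction on the number of
-- vertices, every neighbour u of v that sees D starts an induced tree in u ∪ D with s_D vertices besides u.
-- Keep a set of branches, i.e. pairwise separated trees rooted at neighbours of v, with p_b vertices
-- besides the root, and a list of components not yet used, such that
-- Σ_b p_b(p_b+1) + Σ_D s_D(s_D+1) > K(K+1) with K = k - 2. Initially every p_b is 0.
-- If s_D < Σ (p_b+1) over the branches b seeing D, for every D, then double counting gives
-- K(K+1) < Σ_b (p_b+1)(p_b + Σ_{D seen by b} s_D), so either a single branch extended by all the components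
-- it sees, or all the branches together, form with v a tree on at least K+3 vertices.
-- Otherwise take a violating component C seen by as few branches as possible. Among the branches X seeing C,
-- keep one that maximises the size obtainable from the components seen only by X, let it absorb those
-- components it sees, and drop the rest of X together with the components this leaves unseen; the
-- potential above does not decrease.

open import Defs renaming (sym to adj-sym)
open import Data.Bool using (Bool; true; false; T; T?; not; _∨_)
open import Data.Empty using (⊥)
open import Data.Fin using (Fin; zero; suc; inject₁; fromℕ; _≟_)
import Data.Fin.Properties as Finₚ
open import Data.Fin.Relation.Unary.Top using (view; ‵fromℕ; ‵inject₁)
open import Data.Fin.Subset using (Subset; ∣_∣; ⁅_⁆; _∪_) renaming (_∈_ to _∈ₛ_; ⊥ to ∅)
import Data.Fin.Subset.Properties as Subₚ
open import Data.List as List using (List; []; _∷_; _++_; map; filter; length; concat; allFin)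
open import Data.List.Membership.Propositional using (_∈_; _∉_; lose; find)
open import Data.List.Membership.Propositional.Properties
  using (∈-filter⁺; ∈-filter⁻; ∈-++⁺ˡ; ∈-++⁺ʳ; ∈-++⁻; ∈-concat⁺′; ∈-concat⁻′; ∈-allFin; ∈-length)
import Data.List.Membership.DecPropositional as DecMembership
open import Data.List.Properties using (length-filter; filter-all; filter-notAll; length-++)
open import Data.List.Relation.Binary.Permutation.Propositional using (_↭_; ↭-refl; ↭-trans; ↭-sym; ↭⇒↭ₛ; prep)
import Data.List.Relation.Binary.Permutation.Propositional.Properties as Permₚ
import Data.List.Relation.Binary.Permutation.Setoid.Properties as PermSetoidₚ
open import Data.List.Relation.Binary.Subset.Propositional using (_⊆_)
open import Data.List.Relation.Unary.All as All using (All; []; _∷_)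
import Data.List.Relation.Unary.All.Properties as Allₚ
open import Data.List.Relation.Unary.AllPairs using (AllPairs; []; _∷_)
import Data.List.Relation.Unary.AllPairs.Properties as AllPairsₚ
open import Data.List.Relation.Unary.Any as Any using (Any; here; there; any?)
open import Data.List.Relation.Unary.Unique.Propositional using (Unique)
import Data.List.Relation.Unary.Unique.Propositional.Properties as Uniqueₚ
open import Data.Nat using (ℕ; zero; suc; _+_; _*_; _∸_; _≤_; _<_; z≤n; s≤s; _≤?_; _≤′_; ≤′-refl; ≤′-step)
open import Data.Nat.ListAction using (sum)
open import Data.Nat.Properties hiding (_≟_)
open import Algebra.Properties.CommutativeSemigroup +-commutativeSemigroup using (x∙yz≈y∙xz; x∙yz≈xz∙y; interchange)
open import Data.Nat.Tactic.RingSolver using (solve-∀)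
open import Data.Product using (∃; _×_; _,_; proj₁; proj₂)
open import Data.Sum as Sum using (_⊎_; inj₁; inj₂)
open import Data.Vec as Vec using (_∷_)
open import Function using (_∘_; case_of_)
open import Level using (0ℓ)
open import Relation.Binary.PropositionalEquality
  using (_≡_; _≢_; refl; sym; trans; cong; cong₂; subst; setoid; module ≡-Reasoning)
open import Relation.Nullary using (¬_; Dec; yes; no; contradiction; ¬?)
open import Relation.Nullary.Decidable using (⌊_⌋)
open import Relation.Unary using (Pred; Decidable)

-- Weighted sums over lists and double counting.

total : {A : Set} → (A → ℕ) → List A → ℕ
total f xs = sum (map f xs)

total-filter : {A : Set} {P : Pred A 0ℓ} (P? : Decidable P) (f : A → ℕ) (xs : List A) →
  total f xs ≡ total f (filter P? xs) + total f (filter (¬? ∘ P?) xs)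
total-filter P? f [] = refl
total-filter P? f (x ∷ xs) with P? x
... | yes _ = trans (cong (f x +_) (total-filter P? f xs)) (sym (+-assoc (f x) _ _))
... | no _ = trans (cong (f x +_) (total-filter P? f xs)) (x∙yz≈y∙xz (f x) (total f (filter P? xs)) _)

total-mono : {A : Set} {f g : A → ℕ} {xs : List A} →
  All (λ x → f x ≤ g x) xs → total f xs ≤ total g xs
total-mono [] = z≤n
total-mono (p ∷ ps) = +-mono-≤ p (total-mono ps)

total-+ : {A : Set} (f g : A → ℕ) (xs : List A) →
  total (λ x → f x + g x) xs ≡ total f xs + total g xs
total-+ f g [] = refl
total-+ f g (x ∷ xs) = trans (cong (f x + g x +_) (total-+ f g xs)) (interchange (f x) (g x) _ _)

member-≤-total : {A : Set} (f : A → ℕ) {x : A} {xs : List A} → x ∈ xs → f x ≤ total f xs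
member-≤-total f (here refl) = m≤m+n _ _
member-≤-total f (there x∈) = ≤-trans (member-≤-total f x∈) (m≤n+m _ _)

-- Merging two summands `a` and `t` adds the cross term `2 * (a * t)`, so x(x+1) is superadditive.
-- This later lets all heavy components count as one of their total weight.
total-superadditive : {A : Set} (f : A → ℕ) (xs : List A) →
  total (λ x → f x * suc (f x)) xs ≤ total f xs * suc (total f xs)
total-superadditive f [] = z≤n
total-superadditive f (x ∷ xs) = begin
  a * suc a + total (λ y → f y * suc (f y)) xs ≤⟨ +-monoʳ-≤ (a * suc a) (total-superadditive f xs) ⟩
  a * suc a + t * suc t                         ≤⟨ m≤m+n _ (2 * (a * t)) ⟩
  a * suc a + t * suc t + 2 * (a * t)           ≡⟨ expand a t ⟩
  (a + t) * suc (a + t)                         ∎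
  where
  open ≤-Reasoning
  a = f x
  t = total f xs
  expand : ∀ a t → a * suc a + t * suc t + 2 * (a * t) ≡ (a + t) * suc (a + t)
  expand = solve-∀

*-factorˡ : ∀ a b c → a * b + b * c ≡ b * (a + c)
*-factorˡ = solve-∀

-- A maximiser of `α` works, because a weighted average is at most the maximum; multiplying out
-- avoids division. Membership of `x` makes the list nonempty.
weighted-max : {A : Set} (q α : A → ℕ) {x : A} {xs : List A} → x ∈ xs →
  ∃ λ y → y ∈ xs × total (λ z → q z * α z) xs ≤ α y * total q xs
weighted-max q α {xs = x ∷ []} (here refl) =
  x , here refl , ≤-reflexive (single (q x) (α x))
  where
  single : ∀ a b → a * b + 0 ≡ b * (a + 0)
  single = solve-∀
weighted-max q α {xs = x ∷ []} (there ())
weighted-max q α {xs = x ∷ x₁ ∷ xs} _ with weighted-max q α (here {x = x₁} {xs = xs} refl)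
... | y , y∈ , bound with α x ≤? α y
... | yes p = y , there y∈ , (begin
      q x * α x + total (λ z → q z * α z) (x₁ ∷ xs)  ≤⟨ +-mono-≤ (*-monoʳ-≤ (q x) p) bound ⟩
      q x * α y + α y * total q (x₁ ∷ xs)           ≡⟨ *-factorˡ (q x) (α y) _ ⟩
      α y * (q x + total q (x₁ ∷ xs))               ∎)
  where open ≤-Reasoning
... | no p = x , here refl , (begin
      q x * α x + total (λ z → q z * α z) (x₁ ∷ xs)  ≤⟨ +-monoʳ-≤ (q x * α x) bound ⟩
      q x * α x + α y * total q (x₁ ∷ xs)
        ≤⟨ +-monoʳ-≤ (q x * α x) (*-monoˡ-≤ (total q (x₁ ∷ xs)) (<⇒≤ (≰⇒> p))) ⟩
      q x * α x + α x * total q (x₁ ∷ xs)           ≡⟨ *-factorˡ (q x) (α x) _ ⟩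
      α x * (q x + total q (x₁ ∷ xs))               ∎)
  where open ≤-Reasoning

module _ {A B : Set} {R : A → B → Set} (R? : ∀ a b → Dec (R a b)) (q : A → ℕ) (s : B → ℕ) where

  -- Both sides sum `q a * s b` over the related pairs, once by columns and once by rows.
  total-swap : (as : List A) (bs : List B) →
    total (λ b → s b * total q (filter (λ a → R? a b) as)) bs ≡
    total (λ a → q a * total s (filter (R? a) bs)) as
  total-swap [] [] = refl
  total-swap (a ∷ as) [] = trans (total-swap as []) (cong (_+ total (λ a → q a * 0) as) (sym (*-zeroʳ (q a))))
  total-swap as (b ∷ bs) = trans (cong (s b * total q (filter (λ a → R? a b) as) +_) (total-swap as bs)) (row as)
    where
    row : ∀ as → s b * total q (filter (λ a → R? a b) as) + total (λ a → q a * total s (filter (R? a) bs)) as ≡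
                 total (λ a → q a * total s (filter (R? a) (b ∷ bs))) as
    row [] = trans (+-identityʳ _) (*-zeroʳ (s b))
    row (a ∷ as) with R? a b
    ... | yes _ = trans (collect (s b) (q a) _ _ _) (cong (q a * (s b + total s (filter (R? a) bs)) +_) (row as))
      where
      collect : ∀ s q t u w → s * (q + t) + (q * u + w) ≡ q * (s + u) + (s * t + w)
      collect = solve-∀
    ... | no _ = trans (x∙yz≈y∙xz (s b * total q (filter (λ a → R? a b) as)) (q a * total s (filter (R? a) bs)) _)
        (cong (q a * total s (filter (R? a) bs) +_) (row as))

  -- Since `s b + 1` is at most the total `q` of the entries related to `b`, the cost
  -- `s b * suc (s b)` is at most `s b` times that total. Exchanging the sums moves this cost to the
  -- side of the `a`.
  charging : (p : A → ℕ) → (∀ a → q a ≡ suc (p a)) → (as : List A) (bs : List B) →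
    All (λ b → s b < total q (filter (λ a → R? a b) as)) bs →
    total (λ a → p a * suc (p a)) as + total (λ b → s b * suc (s b)) bs ≤
    total (λ a → q a * (p a + total s (filter (R? a) bs))) as
  charging p q≡ as bs light = begin
    total (λ a → p a * suc (p a)) as + total (λ b → s b * suc (s b)) bs
      ≤⟨ +-mono-≤ (total-mono (All.universal own as)) (total-mono (All.map (λ {b} → *-monoʳ-≤ (s b)) light)) ⟩
    total (λ a → q a * p a) as + total (λ b → s b * total q (filter (λ a → R? a b) as)) bs
      ≡⟨ cong (total (λ a → q a * p a) as +_) (total-swap as bs) ⟩
    total (λ a → q a * p a) as + total (λ a → q a * total s (filter (R? a) bs)) as
      ≡⟨ total-+ (λ a → q a * p a) _ as ⟨
    total (λ a → q a * p a + q a * total s (filter (R? a) bs)) as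
      ≤⟨ total-mono (All.universal (λ a → ≤-reflexive (sym (*-distribˡ-+ (q a) (p a) _))) as) ⟩
    total (λ a → q a * (p a + total s (filter (R? a) bs))) as ∎
    where
    open ≤-Reasoning
    own : ∀ a → p a * suc (p a) ≤ q a * p a
    own a = ≤-reflexive (trans (*-comm (p a) (suc (p a))) (cong (_* p a) (sym (q≡ a))))

-- Selection, filtering and pairwise relations on lists.

minimal-or-none : {A : Set} {P : Pred A 0ℓ} → Decidable P → (f : A → ℕ) (xs : List A) →
  All (¬_ ∘ P) xs ⊎ ∃ λ x → x ∈ xs × P x × (∀ {y} → y ∈ xs → P y → f x ≤ f y)
minimal-or-none P? f [] = inj₁ []
minimal-or-none P? f (x ∷ xs) with P? x | minimal-or-none P? f xs
... | no ¬p | inj₁ none = inj₁ (¬p ∷ none)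
... | no ¬p | inj₂ (y , y∈ , py , min) =
  inj₂ (y , there y∈ , py , λ { (here refl) p → contradiction p ¬p ; (there z∈) → min z∈ })
... | yes p | inj₁ none =
  inj₂ (x , here refl , p , λ { (here refl) _ → ≤-refl ; (there z∈) pz → contradiction pz (All.lookup none z∈) })
... | yes p | inj₂ (y , y∈ , py , min) with f x ≤? f y
... | yes le = inj₂ (x , here refl , p , λ { (here refl) _ → ≤-refl ; (there z∈) pz → ≤-trans le (min z∈ pz) })
... | no ¬le = inj₂ (y , there y∈ , py , λ { (here refl) _ → <⇒≤ (≰⇒> ¬le) ; (there z∈) → min z∈ })

module _ {A : Set} {P Q : Pred A 0ℓ} (P? : Decidable P) (Q? : Decidable Q) where

  filter-refine : ∀ {xs} → All (λ x → P x → Q x) xs → filter P? xs ≡ filter P? (filter Q? xs)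
  filter-refine {[]} [] = refl
  filter-refine {x ∷ xs} (i ∷ is) with Q? x
  filter-refine {x ∷ xs} (i ∷ is) | yes _ with P? x
  ... | yes _ = cong (x ∷_) (filter-refine is)
  ... | no _ = filter-refine is
  filter-refine {x ∷ xs} (i ∷ is) | no ¬q with P? x
  ... | yes p = contradiction (i p) ¬q
  ... | no _ = filter-refine is

  filter-length-mono : ∀ {xs} → All (λ x → P x → Q x) xs → length (filter P? xs) ≤ length (filter Q? xs)
  filter-length-mono {xs} is = ≤-trans (≤-reflexive (cong length (filter-refine is))) (length-filter P? (filter Q? xs))

  -- Given that `P` implies `Q`, an entry with `Q` but not `P` would make the `Q`-count strictly
  -- larger than the `P`-count.
  filter-squeeze : ∀ {xs} → All (λ x → P x → Q x) xs → length (filter Q? xs) ≤ length (filter P? xs) →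
    All (λ x → Q x → P x) xs
  filter-squeeze {[]} [] _ = []
  filter-squeeze {x ∷ xs} (i ∷ is) le with Q? x | P? x
  ... | yes _ | yes p = (λ _ → p) ∷ filter-squeeze is (≤-pred le)
  ... | yes _ | no _ = contradiction le (<⇒≱ (s≤s (filter-length-mono is)))
  ... | no ¬q | yes p = contradiction (i p) ¬q
  ... | no ¬q | no _ = (λ q → contradiction q ¬q) ∷ filter-squeeze is le

  total-filter² : (f : A → ℕ) (xs : List A) →
    total f (filter P? xs) ≡ total f (filter P? (filter Q? xs)) + total f (filter P? (filter (¬? ∘ Q?) xs))
  total-filter² f [] = refl
  total-filter² f (x ∷ xs) with Q? x
  total-filter² f (x ∷ xs) | yes _ with P? x
  ... | yes _ = trans (cong (f x +_) (total-filter² f xs)) (sym (+-assoc (f x) _ _))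
  ... | no _ = total-filter² f xs
  total-filter² f (x ∷ xs) | no _ with P? x
  ... | yes _ = trans (cong (f x +_) (total-filter² f xs)) (x∙yz≈y∙xz (f x) (total f (filter P? (filter Q? xs))) _)
  ... | no _ = total-filter² f xs

AllPairs-lookup : {A : Set} {R : A → A → Set} → (∀ {x y} → R x y → R y x) →
  ∀ {xs x y} → AllPairs R xs → x ∈ xs → y ∈ xs → x ≡ y ⊎ R x y
AllPairs-lookup s (r ∷ rs) (here refl) (here refl) = inj₁ refl
AllPairs-lookup s (r ∷ rs) (here refl) (there y∈) = inj₂ (All.lookup r y∈)
AllPairs-lookup s (r ∷ rs) (there x∈) (here refl) = inj₂ (s (All.lookup r x∈))
AllPairs-lookup s (r ∷ rs) (there x∈) (there y∈) = AllPairs-lookup s rs x∈ y∈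

-- `P` tells the two entries apart, so they occupy different positions of the list.
AllPairs-cross : {A : Set} {R : A → A → Set} (P : Pred A 0ℓ) → (∀ {x y} → R x y → R y x) →
  ∀ {xs x y} → AllPairs R xs → x ∈ xs → P x → y ∈ xs → ¬ P y → R x y
AllPairs-cross P s rs x∈ px y∈ ¬py with AllPairs-lookup s rs x∈ y∈
... | inj₁ refl = contradiction px ¬py
... | inj₂ r = r

AllPairs-concat⁻ : {A : Set} {R : A → A → Set} → ∀ xss → AllPairs R (concat xss) → All (AllPairs R) xss
AllPairs-concat⁻ [] _ = []
AllPairs-concat⁻ {R = R} (xs ∷ xss) rs = proj₁ (split xs rs) ∷ AllPairs-concat⁻ xss (proj₂ (split xs rs))
  where
  split : ∀ xs {ys} → AllPairs R (xs ++ ys) → AllPairs R xs × AllPairs R ys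
  split [] rs = [] , rs
  split (x ∷ xs) (r ∷ rs) = Allₚ.++⁻ˡ xs r ∷ proj₁ (split xs rs) , proj₂ (split xs rs)

concat-filter-↭ : {A : Set} {P : Pred (List A) 0ℓ} (P? : Decidable P) → ∀ xss →
  concat (filter P? xss) ++ concat (filter (¬? ∘ P?) xss) ↭ concat xss
concat-filter-↭ P? [] = ↭-refl
concat-filter-↭ P? (xs ∷ xss) with P? xs
... | yes _ = ↭-trans (Permₚ.++-assoc xs (concat (filter P? xss)) _) (Permₚ.++⁺ˡ xs (concat-filter-↭ P? xss))
... | no _ = ↭-trans (Permₚ.shifts (concat (filter P? xss)) xs) (Permₚ.++⁺ˡ xs (concat-filter-↭ P? xss))

length-filter-complement : {A : Set} {P : Pred A 0ℓ} (P? : Decidable P) → ∀ xs →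
  length (filter P? xs) + length (filter (¬? ∘ P?) xs) ≡ length xs
length-filter-complement P? [] = refl
length-filter-complement P? (x ∷ xs) with P? x
... | yes _ = cong suc (length-filter-complement P? xs)
... | no _ = trans (+-suc _ _) (cong suc (length-filter-complement P? xs))

length-concat-bound : {A : Set} {f : List A → ℕ} {xss : List (List A)} →
  All (λ xs → 2 * length xs ≤ f xs) xss → 2 * length (concat xss) ≤ total f xss
length-concat-bound [] = z≤n
length-concat-bound {xss = xs ∷ xss} (p ∷ ps) = ≤-trans
  (≤-reflexive (trans (cong (2 *_) (length-++ xs)) (*-distribˡ-+ 2 (length xs) _)))
  (+-mono-≤ p (length-concat-bound ps))

-- The enumeration `h` is arbitrary so that the induction can pass to `h ∘ suc`.
length-tabulate-filter : ∀ {n} {A : Set} (f : A → Bool) (h : Fin n → A) →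
  ∣ Vec.tabulate (f ∘ h) ∣ ≡ length (filter (T? ∘ f) (List.tabulate h))
length-tabulate-filter {zero} f h = refl
length-tabulate-filter {suc n} f h with f (h zero)
... | true = cong suc (length-tabulate-filter f (h ∘ suc))
... | false = length-tabulate-filter f (h ∘ suc)

-- The index of the least triangular number that is at least d, with triangular numbers doubled.
triangularRoot : ∀ d → ∃ λ s → 2 * d ≤ s * suc s × (∀ {r} → s ≡ suc r → r * suc r < 2 * d)
triangularRoot zero = 0 , z≤n , λ ()
triangularRoot (suc d) with triangularRoot d
... | s , upper , lower with 2 * suc d ≤? s * suc s
... | yes p = s , p , λ eq → <-≤-trans (lower eq) (*-monoʳ-≤ 2 (n≤1+n d))
... | no ¬p = suc s , (begin
        2 * suc d                ≡⟨ *-suc 2 d ⟩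
        2 + 2 * d                ≤⟨ +-mono-≤ (m≤m+n 2 (2 * s)) upper ⟩
        2 + 2 * s + s * suc s    ≡⟨ next s ⟩
        suc s * suc (suc s)      ∎) , λ { refl → ≰⇒> ¬p }
  where
  open ≤-Reasoning
  next : ∀ s → 2 + 2 * s + s * suc s ≡ suc s * suc (suc s)
  next = solve-∀

length-≤-concat : {A : Set} {xs : List A} {xss : List (List A)} → xs ∈ xss → length xs ≤ length (concat xss)
length-≤-concat {xs = xs} (here refl) = ≤-trans (m≤m+n _ _) (≤-reflexive (sym (length-++ xs)))
length-≤-concat (there {x = ys} xs∈) = ≤-trans (length-≤-concat xs∈)
  (≤-trans (m≤n+m _ (length ys)) (≤-reflexive (sym (length-++ ys))))

-- Walks.

module _ {n : ℕ} {E : Fin n → Fin n → Set} where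

  walk-++ : ∀ {x y z} → Walk E x y → Walk E y z → Walk E x z
  walk-++ here w = w
  walk-++ (step e w) w′ = step e (walk-++ w w′)

  walk-reverse : (∀ {x y} → E x y → E y x) → ∀ {x y} → Walk E x y → Walk E y x
  walk-reverse s here = here
  walk-reverse s (step e w) = walk-++ (walk-reverse s w) (step (s e) here)

  walk-map : {F : Fin n → Fin n → Set} → (∀ {x y} → E x y → F x y) → ∀ {x y} → Walk E x y → Walk F x y
  walk-map f here = here
  walk-map f (step e w) = step (f e) (walk-map f w)

  walk-exit : {P : Fin n → Set} → (∀ x → Dec (P x)) → ∀ {x y} → Walk E x y → P x → ¬ P y →
    ∃ λ a → ∃ λ b → P a × ¬ P b × E a b
  walk-exit P? here px ¬py = contradiction px ¬py
  walk-exit P? (step {x} {y} e w) px ¬pz with P? y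
  ... | yes py = walk-exit P? w py ¬pz
  ... | no ¬py = x , y , px , ¬py , e

-- Trees grown leaf by leaf, and why they are induced trees.

module Trees {n : ℕ} (G : Graph n) where

  V : Set
  V = Fin n

  infix 4 _~_
  _~_ : V → V → Set
  x ~ y = Adj G x y

  ~-sym : ∀ {x y} → x ~ y → y ~ x
  ~-sym {x} {y} = subst T (adj-sym G x y)

  ~⇒≢ : ∀ {x y} → x ~ y → x ≢ y
  ~⇒≢ {x} x~x refl = subst T (loopless G x) x~x

  _~?_ : ∀ x y → Dec (x ~ y)
  x ~? y = T? (adj G x y)

  -- Grown r L: L lists, latest first, the vertices of a tree obtained from r by attaching leaves.
  data Grown (r : V) : List V → Set where
    root : Grown r (r ∷ [])
    leaf : ∀ {x y L} → Grown r L → y ∈ L → x ~ y → (∀ {z} → z ∈ L → x ~ z → z ≡ y) → x ∉ L → Grown r (x ∷ L)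

  root∈ : ∀ {r L} → Grown r L → r ∈ L
  root∈ root = here refl
  root∈ (leaf g _ _ _ _) = there (root∈ g)

  -- The index s does not count the root: the tree has s + 1 vertices.
  Tree : V → List V → ℕ → Set
  Tree r C s = ∃ λ L → Grown r L × length L ≡ suc s × (∀ {x} → x ∈ L → x ≡ r ⊎ x ∈ C)

  -- With at least two vertices the latest one is a leaf, and deleting it leaves a grown tree.
  -- Iterated in `shrink`, this makes lower bounds on sizes sufficient.
  prune : ∀ {r C s} → Tree r C (suc s) → Tree r C s
  prune (_ , leaf g _ _ _ _ , eq , scope) = _ , g , suc-injective eq , scope ∘ there

  shrink : ∀ {r C s t} → s ≤ t → Tree r C t → Tree r C s
  shrink {r} {C} {s} {t} s≤t = go (≤⇒≤′ s≤t)
    where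
    go : ∀ {t} → s ≤′ t → Tree r C t → Tree r C s
    go ≤′-refl tree = tree
    go (≤′-step s≤t) tree = go s≤t (prune tree)

  -- The leaf attachments of `M` are replayed on top of `L`. Away from `u`, vertices of `M` can meet
  -- `L` only in edges to `u`, so each new leaf keeps a single neighbour. The shared vertex `u` is
  -- counted twice, hence the `suc`.
  glue : ∀ {r u L M} → Grown r L → u ∈ L → Grown u M →
    (∀ {x} → x ∈ M → x ≢ u → x ∉ L × (∀ {z} → z ∈ L → x ~ z → z ≡ u)) →
    ∃ λ L′ → Grown r L′ × length L + length M ≡ suc (length L′) ×
      (∀ {z} → z ∈ L′ → z ∈ L ⊎ z ∈ M) × L ⊆ L′ × M ⊆ L′
  glue {L = L} g u∈ root _ =
    L , g , +-comm (length L) 1 , inj₁ , (λ z → z) , λ { (here refl) → u∈ ; (there ()) }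
  glue {u = u} {L = L} g u∈ (leaf {x} {y} {M} h y∈ x~y uniq x∉) sep
    with glue g u∈ h (λ z∈ → sep (there z∈))
  ... | L′ , g′ , len , from , L⊆ , M⊆ =
    x ∷ L′ , leaf g′ (M⊆ y∈) x~y uniq′ x∉′ ,
    trans (+-suc (length L) (length M)) (cong suc len) , from′ ,
    there ∘ L⊆ , λ { (here refl) → here refl ; (there z∈) → there (M⊆ z∈) }
    where
    x≢u : x ≢ u
    x≢u refl = x∉ (root∈ h)
    uniq′ : ∀ {z} → z ∈ L′ → x ~ z → z ≡ y
    uniq′ z∈ x~z with from z∈
    ... | inj₂ z∈M = uniq z∈M x~z
    -- A neighbour of `x` in `L` must be `u`; as the root of the second tree, `u` is already covered
    -- by the uniqueness of `y`.
    ... | inj₁ z∈L with refl ← proj₂ (sep (here refl) x≢u) z∈L x~z = uniq (root∈ h) x~z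
    x∉′ : x ∉ L′
    x∉′ x∈ with from x∈
    ... | inj₁ x∈L = proj₁ (sep (here refl) x≢u) x∈L
    ... | inj₂ x∈M = x∉ x∈M
    from′ : ∀ {z} → z ∈ x ∷ L′ → z ∈ L ⊎ z ∈ x ∷ M
    from′ (here refl) = inj₂ (here refl)
    from′ (there z∈) with from z∈
    ... | inj₁ z∈L = inj₁ z∈L
    ... | inj₂ z∈M = inj₂ (there z∈M)

  grown-walk : ∀ {r L x} → Grown r L → x ∈ L → Walk (λ a b → a ∈ L × b ∈ L × a ~ b) x r
  grown-walk root (here refl) = here
  grown-walk (leaf g y∈ x~y _ _) (here refl) =
    step (here refl , there y∈ , x~y) (walk-map (λ (a , b , e) → there a , there b , e) (grown-walk g y∈))
  grown-walk (leaf g _ _ _ _) (there x∈) = walk-map (λ (a , b , e) → there a , there b , e) (grown-walk g x∈)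

  module _ {m : ℕ} (c : Fin (3 + m) → V) (c-inj : ∀ {i j} → c i ≡ c j → i ≡ j)
    (c-path : ∀ j → c (inject₁ j) ~ c (suc j)) (c-close : c (fromℕ (2 + m)) ~ c zero) where

    two-neighbours : ∀ i → ∃ λ j → ∃ λ k → j ≢ k × c i ~ c j × c i ~ c k
    two-neighbours zero = suc zero , fromℕ (2 + m) , (λ ()) , c-path zero , ~-sym c-close
    two-neighbours (suc i) with view i
    ... | ‵fromℕ = inject₁ (fromℕ (suc m)) , zero , (λ ()) , ~-sym (c-path (fromℕ (suc m))) , c-close
    ... | ‵inject₁ j = inject₁ (inject₁ j) , suc (suc j) , apart j , ~-sym (c-path (inject₁ j)) , c-path (suc j)
      where
      apart : ∀ {m} (j : Fin m) → inject₁ (inject₁ j) ≢ suc (suc j)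
      apart zero ()
      apart (suc j) eq = apart j (Finₚ.suc-injective eq)

    -- The most recently attached vertex of the cycle would have both its cycle neighbours among the
    -- earlier vertices, but a leaf has only one neighbour there.
    no-cycle : ∀ {r L} → Grown r L → (∀ i → c i ∈ L) → ⊥
    no-cycle root c∈ with c∈ zero | c∈ (suc zero)
    ... | here p | here q with () ← c-inj (trans p (sym q))
    no-cycle (leaf {x} {y} {L} g _ _ uniq x∉) c∈ with Finₚ.any? (λ i → c i ≟ x)
    ... | no c≢x = no-cycle g (λ i → tail-∈ (c∈ i) (λ eq → c≢x (i , eq)))
      where
      tail-∈ : ∀ {z} → z ∈ x ∷ L → z ≢ x → z ∈ L
      tail-∈ (here eq) ne = contradiction eq ne
      tail-∈ (there z∈) _ = z∈
    ... | yes (i , refl) with j , k , j≢k , ej , ek ← two-neighbours i =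
      j≢k (c-inj (trans (uniq (other ej) ej) (sym (uniq (other ek) ek))))
      where
      other : ∀ {j} → c i ~ c j → c j ∈ L
      other {j} e with c∈ j
      ... | here eq = contradiction (sym eq) (~⇒≢ e)
      ... | there z∈ = z∈

  toSubset : List V → Subset n
  toSubset [] = ∅
  toSubset (x ∷ L) = ⁅ x ⁆ ∪ toSubset L

  toSubset⁺ : ∀ {x L} → x ∈ L → x ∈ₛ toSubset L
  toSubset⁺ {L = y ∷ L} (here refl) = Subₚ.p⊆p∪q (toSubset L) (Subₚ.x∈⁅x⁆ y)
  toSubset⁺ {L = y ∷ L} (there x∈) = Subₚ.q⊆p∪q ⁅ y ⁆ (toSubset L) (toSubset⁺ x∈)

  toSubset⁻ : ∀ {x L} → x ∈ₛ toSubset L → x ∈ L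
  toSubset⁻ {L = []} x∈ = contradiction x∈ Subₚ.∉⊥
  toSubset⁻ {L = y ∷ L} x∈ with Subₚ.x∈p∪q⁻ ⁅ y ⁆ (toSubset L) x∈
  ... | inj₁ x∈y = here (Subₚ.x∈⁅y⁆⇒x≡y y x∈y)
  ... | inj₂ x∈L = there (toSubset⁻ x∈L)

  ∣⁅x⁆∪p∣ : ∀ {n} (x : Fin n) (p : Subset n) → ¬ x ∈ₛ p → ∣ ⁅ x ⁆ ∪ p ∣ ≡ suc ∣ p ∣
  ∣⁅x⁆∪p∣ zero (true ∷ p) x∉ = contradiction Vec.here x∉
  ∣⁅x⁆∪p∣ zero (false ∷ p) x∉ = cong (suc ∘ ∣_∣) (Subₚ.∪-identityˡ p)
  ∣⁅x⁆∪p∣ (suc x) (true ∷ p) x∉ = cong suc (∣⁅x⁆∪p∣ x p (x∉ ∘ Vec.there))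
  ∣⁅x⁆∪p∣ (suc x) (false ∷ p) x∉ = ∣⁅x⁆∪p∣ x p (x∉ ∘ Vec.there)

  ∣toSubset∣ : ∀ {r L} → Grown r L → ∣ toSubset L ∣ ≡ length L
  ∣toSubset∣ {r} root = trans (cong ∣_∣ (Subₚ.∪-identityʳ ⁅ r ⁆)) (Subₚ.∣⁅x⁆∣≡1 r)
  ∣toSubset∣ (leaf {x} {L = L} g _ _ _ x∉) =
    trans (∣⁅x⁆∪p∣ x (toSubset L) (x∉ ∘ toSubset⁻)) (cong suc (∣toSubset∣ g))

  inducedTree : ∀ {r L} → Grown r L → InducedTree G (toSubset L)
  inducedTree {L = L} g = connected , acyclic
    where
    connected : InducedConnected G (toSubset L)
    connected x y x∈ y∈ = walk-map (λ (a , b , e) → toSubset⁺ a , toSubset⁺ b , e)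
      (walk-++ (grown-walk g (toSubset⁻ x∈))
        (walk-reverse (λ (a , b , e) → b , a , ~-sym e) (grown-walk g (toSubset⁻ y∈))))
    acyclic : InducedAcyclic G (toSubset L)
    acyclic cyc = no-cycle c c-inj c-path c-close g (toSubset⁻ ∘ c-in)
      where open InducedCycle cyc

-- Separated vertex lists.

module Separation {n : ℕ} (G : Graph n) where
  open Trees G public

  Separated : List V → List V → Set
  Separated A B = ∀ {x y} → x ∈ A → y ∈ B → x ≢ y × ¬ x ~ y

  separated-sym : ∀ {A B} → Separated A B → Separated B A
  separated-sym sep y∈ x∈ with sep x∈ y∈
  ... | x≢y , x≁y = x≢y ∘ sym , x≁y ∘ ~-sym

  Sees : V → List V → Set
  Sees u D = Any (u ~_) D

  sees? : ∀ u D → Dec (Sees u D)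
  sees? u = any? (u ~?_)

-- Branches rooted at neighbours of v, and how they combine.

module Gathering {n : ℕ} (G : Graph n) (v : Fin n) (N W : List (Fin n))
  (N-near : ∀ {u} → u ∈ N → Adj G v u) (W-far : ∀ {x} → x ∈ W → x ≢ v × ¬ Adj G v x)
  (weight : List (Fin n) → ℕ) where
  open Separation G

  record Branch : Set where
    field
      top    : V
      top∈   : top ∈ N
      body   : List V
      grown  : Grown top body
      excess : ℕ
      length-body : length body ≡ suc excess
      scope  : ∀ {x} → x ∈ body → x ≡ top ⊎ x ∈ W
  open Branch

  order : Branch → ℕ
  order b = suc (excess b)

  -- The form in which the induction hypothesis about a component reaches this module; `weight`
  -- plays the role of s_D.
  Block : List V → Set
  Block D = D ⊆ W × (∀ {u} → u ∈ N → Sees u D → Tree u D (weight D))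

  _touches_ : Branch → List V → Set
  b touches D = Sees (top b) D

  touches? : ∀ b D → Dec (b touches D)
  touches? b = sees? (top b)

  -- This is the separation that `glue` requires to hang a tree inside `D` at the top of `b`.
  Outside : Branch → List V → Set
  Outside b D = ∀ {x y} → x ∈ D → y ∈ body b → x ≢ y × (x ~ y → y ≡ top b)

  near≢far : ∀ {u x} → u ∈ N → x ∈ W → x ≢ u
  near≢far u∈ x∈ refl = proj₂ (W-far x∈) (N-near u∈)

  -- Each block supplies a tree rooted at the top, and these are glued there one after another:
  -- `Outside` separates a block from the old body, `Separated` from the blocks already absorbed.
  -- The origin of every vertex is recorded for later separation arguments.
  absorb : ∀ b {Ds} → All Block Ds → AllPairs Separated Ds → All (Outside b) Ds → All (b touches_) Ds →
    ∃ λ b′ → top b′ ≡ top b × excess b′ ≡ excess b + total weight Ds ×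
      (∀ {x} → x ∈ body b′ → x ∈ body b ⊎ Any (x ∈_) Ds)
  absorb b [] [] [] [] = b , refl , sym (+-identityʳ _) , inj₁
  absorb b {D ∷ Ds} ((D⊆W , tree) ∷ blocks) (sep ∷ seps) (out ∷ outs) (sees ∷ seen)
    with absorb b blocks seps outs seen
  ... | b₁ , refl , size , from
    with tree (top∈ b₁) sees
  ... | M , gM , lenM , scopeM
    with glue (grown b₁) (root∈ (grown b₁)) gM apart
    where
    outside₁ : Outside b₁ D
    outside₁ x∈ y∈ with from y∈
    ... | inj₁ y∈b = out x∈ y∈b
    ... | inj₂ y∈Ds with D′ , D′∈ , y∈D′ ← find y∈Ds with x≢y , x≁y ← All.lookup sep D′∈ x∈ y∈D′ =
      x≢y , λ e → contradiction e x≁y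
    apart : ∀ {x} → x ∈ M → x ≢ top b₁ →
      x ∉ body b₁ × (∀ {z} → z ∈ body b₁ → x ~ z → z ≡ top b₁)
    apart x∈ x≢u with scopeM x∈
    ... | inj₁ x≡u = contradiction x≡u x≢u
    ... | inj₂ x∈D = (λ x∈b → proj₁ (outside₁ x∈D x∈b) refl) , λ z∈ → proj₂ (outside₁ x∈D z∈)
  ... | L , gL , lenL , fromL , _ , _ = record
    { top = top b₁ ; top∈ = top∈ b₁ ; body = L ; grown = gL
    ; excess = excess b + total weight (D ∷ Ds)
    ; length-body = lengthL
    ; scope = scopeL
    } , refl , refl , fromb
    where
    lengthL : length L ≡ suc (excess b + (weight D + total weight Ds))
    lengthL = suc-injective (begin
      suc (length L)                                              ≡⟨ lenL ⟨
      length (body b₁) + length M                                  ≡⟨ cong₂ _+_ (trans (length-body b₁) (cong suc size)) lenM ⟩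
      suc (excess b + total weight Ds) + suc (weight D)            ≡⟨ shuffle (excess b) (total weight Ds) (weight D) ⟩
      suc (suc (excess b + (weight D + total weight Ds)))          ∎)
      where
      open ≡-Reasoning
      shuffle : ∀ a b c → suc (a + b) + suc c ≡ suc (suc (a + (c + b)))
      shuffle = solve-∀
    scopeL : ∀ {x} → x ∈ L → x ≡ top b₁ ⊎ x ∈ W
    scopeL x∈ with fromL x∈
    ... | inj₁ x∈b = scope b₁ x∈b
    ... | inj₂ x∈M with scopeM x∈M
    ... | inj₁ x≡u = inj₁ x≡u
    ... | inj₂ x∈D = inj₂ (D⊆W x∈D)
    fromb : ∀ {x} → x ∈ L → x ∈ body b ⊎ Any (x ∈_) (D ∷ Ds)
    fromb x∈ with fromL x∈
    fromb x∈ | inj₂ x∈M with scopeM x∈M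
    ... | inj₂ x∈D = inj₂ (here x∈D)
    ... | inj₁ refl with from (root∈ (grown b₁))
    ... | inj₁ z = inj₁ z
    ... | inj₂ z = inj₂ (there z)
    fromb x∈ | inj₁ x∈b with from x∈b
    ... | inj₁ z = inj₁ z
    ... | inj₂ z = inj₂ (there z)

  branches-apart : ∀ {bs} b → All (λ b′ → Separated (body b) (body b′)) bs →
    ∀ {x y} → x ∈ body b → Any (λ b′ → y ∈ body b′) bs → x ≢ y × ¬ x ~ y
  branches-apart b sep x∈ y∈ with b′ , b′∈ , y∈b′ ← find y∈ = All.lookup sep b′∈ x∈ y∈b′

  -- The tops are joined to v as leaves, and each body is then glued at its top. The remaining body
  -- vertices lie in `W`, hence are not adjacent to v, and distinct branches are separated.
  plant : ∀ {bs} → AllPairs (λ b b′ → Separated (body b) (body b′)) bs →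
    ∃ λ L → Grown v L × length L ≡ suc (total order bs) × (∀ {x} → x ∈ L → x ≡ v ⊎ Any (λ b → x ∈ body b) bs)
  plant [] = v ∷ [] , root , refl , λ { (here eq) → inj₁ eq ; (there ()) }
  plant {b ∷ bs} (sep ∷ seps) with plant seps
  ... | L , gL , lenL , fromL
    with glue (leaf gL (root∈ gL) (~-sym (N-near (top∈ b))) unique-neighbour fresh) (here refl) (grown b) apart
    where
    u∈b : top b ∈ body b
    u∈b = root∈ (grown b)
    u≢v : top b ≢ v
    u≢v eq = ~⇒≢ (N-near (top∈ b)) (sym eq)
    unique-neighbour : ∀ {z} → z ∈ L → top b ~ z → z ≡ v
    unique-neighbour z∈ e with fromL z∈
    ... | inj₁ z≡v = z≡v
    ... | inj₂ z∈bs = contradiction e (proj₂ (branches-apart b sep u∈b z∈bs))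
    fresh : top b ∉ L
    fresh u∈ with fromL u∈
    ... | inj₁ u≡v = u≢v u≡v
    ... | inj₂ u∈bs = proj₁ (branches-apart b sep u∈b u∈bs) refl
    apart : ∀ {x} → x ∈ body b → x ≢ top b →
      x ∉ top b ∷ L × (∀ {z} → z ∈ top b ∷ L → x ~ z → z ≡ top b)
    apart {x} x∈ x≢u with scope b x∈
    ... | inj₁ x≡u = contradiction x≡u x≢u
    ... | inj₂ x∈W = x∉ , uniq
      where
      x∉ : x ∉ top b ∷ L
      x∉ (here x≡u) = x≢u x≡u
      x∉ (there x∈L) with fromL x∈L
      ... | inj₁ x≡v = proj₁ (W-far x∈W) x≡v
      ... | inj₂ x∈bs = proj₁ (branches-apart b sep x∈ x∈bs) refl
      uniq : ∀ {z} → z ∈ top b ∷ L → x ~ z → z ≡ top b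
      uniq (here z≡u) _ = z≡u
      uniq (there z∈L) e with fromL z∈L
      ... | inj₁ refl = contradiction (~-sym e) (proj₂ (W-far x∈W))
      ... | inj₂ z∈bs = contradiction e (proj₂ (branches-apart b sep x∈ z∈bs))
  ... | L′ , gL′ , lenL′ , fromL′ , _ , _ = L′ , gL′ , lengthL′ , from
    where
    lengthL′ : length L′ ≡ suc (order b + total order bs)
    lengthL′ = suc-injective (trans (sym lenL′) (trans (cong₂ (λ l m → suc l + m) lenL (length-body b))
      (cong (2 +_) (+-comm (total order bs) (order b)))))
    from : ∀ {x} → x ∈ L′ → x ≡ v ⊎ Any (λ b → x ∈ body b) (b ∷ bs)
    from x∈ with fromL′ x∈
    ... | inj₂ x∈b = inj₂ (here x∈b)
    ... | inj₁ (here refl) = inj₂ (here (root∈ (grown b)))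
    ... | inj₁ (there x∈L) with fromL x∈L
    ... | inj₁ x≡v = inj₁ x≡v
    ... | inj₂ x∈bs = inj₂ (there x∈bs)

  -- The invariant, and the case where double counting applies.

  record State (K : ℕ) (bs : List Branch) (Ds : List (List V)) : Set where
    field
      blocks  : All Block Ds
      bs-sep  : AllPairs (λ b b′ → Separated (body b) (body b′)) bs
      Ds-sep  : AllPairs Separated Ds
      outside : All (λ b → All (Outside b) Ds) bs
      covered : All (λ D → Any (_touches D) bs) Ds
      mass    : K * suc K < total (λ b → excess b * suc (excess b)) bs + total (λ D → weight D * suc (weight D)) Ds

  planted : ∀ {K bs} → AllPairs (λ b b′ → Separated (body b) (body b′)) bs → suc K < total order bs →
    Tree v (N ++ W) (2 + K)
  planted {K} {bs} seps large with plant seps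
  ... | L , gL , lenL , fromL = shrink large (L , gL , lenL , within)
    where
    within : ∀ {x} → x ∈ L → x ≡ v ⊎ x ∈ N ++ W
    within x∈ with fromL x∈
    ... | inj₁ x≡v = inj₁ x≡v
    ... | inj₂ x∈bs with b , _ , x∈b ← find x∈bs with scope b x∈b
    ... | inj₁ refl = inj₂ (∈-++⁺ˡ (top∈ b))
    ... | inj₂ x∈W = inj₂ (∈-++⁺ʳ N x∈W)

  seers : List Branch → List V → List Branch
  seers bs D = filter (λ b → touches? b D) bs

  -- The negation of the hypothesis of `charging`: a component that its seers cannot pay for.
  Heavy : List Branch → List V → Set
  Heavy bs D = total order (seers bs D) ≤ weight D

  heavy? : ∀ bs D → Dec (Heavy bs D)
  heavy? bs D = total order (seers bs D) ≤? weight D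

  light-charging : ∀ bs {Ds} → All (λ D → weight D < total order (seers bs D)) Ds →
    total (λ b → excess b * suc (excess b)) bs + total (λ D → weight D * suc (weight D)) Ds ≤
    total (λ b → order b * (excess b + total weight (filter (touches? b) Ds))) bs
  light-charging bs {Ds} = charging touches? order weight excess (λ _ → refl) bs Ds

  -- Charging and `weighted-max` bound the mass by the extended excess of one branch `u` times the
  -- total order. If the first factor were at most K and the second at most K + 1, the mass could
  -- not exceed K(K+1).
  no-heavy : ∀ {K bs Ds} → State K bs Ds → All (¬_ ∘ Heavy bs) Ds → Tree v (N ++ W) (2 + K)
  no-heavy {K} {[]} {Ds} st none =
    -- Without branches the charging bound is an empty sum, so the mass would be 0.
    contradiction (<-≤-trans (State.mass st) (light-charging [] (All.map ≰⇒> none))) λ ()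
  no-heavy {K} {b ∷ bs} {Ds} st none
    with weighted-max order (λ b → excess b + total weight (filter (touches? b) Ds)) (here {x = b} {xs = bs} refl)
  ... | u , u∈ , bound
    with suc K ≤? excess u + total weight (filter (touches? u) Ds) | 2 + K ≤? total order (b ∷ bs)
  ... | _ | yes many = planted (State.bs-sep st) many
  ... | yes big | no _
    with absorb u (Allₚ.filter⁺ (touches? u) (State.blocks st)) (AllPairsₚ.filter⁺ (touches? u) (State.Ds-sep st))
           (Allₚ.filter⁺ (touches? u) (All.lookup (State.outside st) u∈)) (Allₚ.all-filter (touches? u) Ds)
  -- The top of `u′` supplies the missing unit: an excess of K + 1 means K + 2 vertices.
  ... | u′ , _ , size , _ = planted {bs = u′ ∷ []} ([] ∷ []) (begin
    2 + K                                                      ≤⟨ s≤s big ⟩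
    suc (excess u + total weight (filter (touches? u) Ds))     ≡⟨ cong suc size ⟨
    order u′                                                   ≡⟨ +-identityʳ (order u′) ⟨
    order u′ + 0                                               ∎)
    where open ≤-Reasoning
  no-heavy {K} {b ∷ bs} {Ds} st none | u , u∈ , bound | no small | no few =
    contradiction (State.mass st) (≤⇒≯ (begin
      total (λ b → excess b * suc (excess b)) (b ∷ bs) + total (λ D → weight D * suc (weight D)) Ds
        ≤⟨ light-charging (b ∷ bs) (All.map ≰⇒> none) ⟩
      total (λ b → order b * (excess b + total weight (filter (touches? b) Ds))) (b ∷ bs)
        ≤⟨ bound ⟩
      (excess u + total weight (filter (touches? u) Ds)) * total order (b ∷ bs)
        ≤⟨ *-mono-≤ (≤-pred (≰⇒> small)) (≤-pred (≰⇒> few)) ⟩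
      K * suc K ∎))
    where open ≤-Reasoning

  -- Removing a heavy component seen by the fewest branches.

  module Absorption {K bs Ds} (st : State K bs Ds) {C} (C∈ : C ∈ Ds) (C-heavy : Heavy bs C)
    (C-minimal : ∀ {D} → D ∈ Ds → Heavy bs D → length (seers bs C) ≤ length (seers bs D)) where
    open State st
    open ≤-Reasoning

    private
      touchesC? : ∀ b → Dec (b touches C)
      touchesC? b = touches? b C

      X Y : List Branch
      X = seers bs C
      Y = filter (¬? ∘ touchesC?) bs

      shared? : ∀ D → Dec (Any (_touches D) Y)
      shared? D = any? (λ b → touches? b D) Y

      -- The `shared` components survive this round; those in `private′` are seen by no branch
      -- outside `X` and are either absorbed or dropped.
      shared private′ heavy light : List (List V)
      shared = filter shared? Ds
      private′ = filter (¬? ∘ shared?) Ds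
      heavy = filter (heavy? bs) private′
      light = filter (¬? ∘ heavy? bs) private′

      -- The size obtainable without the heavy private components. Those contribute the same amount
      -- `S` to every branch of `X`, so `α` suffices to compare branches.
      α : Branch → ℕ
      α b = excess b + total weight (filter (touches? b) light)

      S : ℕ
      S = total weight heavy

      -- A branch that sees `D` but not `C` would lie in `Y` and make `D` shared.
      refines : ∀ {D} → D ∈ private′ → All (λ b → b touches D → b touches C) bs
      refines {D} D∈ = All.tabulate λ {b} b∈ b-D → case touchesC? b of λ where
        (yes b-C) → b-C
        (no ¬b-C) → contradiction (lose (∈-filter⁺ (¬? ∘ touchesC?) b∈ ¬b-C) b-D)
                                  (proj₂ (∈-filter⁻ (¬? ∘ shared?) {xs = Ds} D∈))

      C∈private : C ∈ private′
      C∈private = ∈-filter⁺ (¬? ∘ shared?) C∈ λ C-shared → case find C-shared of λ where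
        (b , b∈ , b-C) → proj₂ (∈-filter⁻ (¬? ∘ touchesC?) {xs = bs} b∈) b-C

      -- By minimality of C, a component D that is heavy and seen only by X is seen by all of X.
      heavy-seen : ∀ {b D} → b ∈ X → D ∈ heavy → b touches D
      heavy-seen {b} {D} b∈ D∈ with D∈p , D-heavy ← ∈-filter⁻ (heavy? bs) {xs = private′} D∈
        with D∈Ds , _ ← ∈-filter⁻ (¬? ∘ shared?) {xs = Ds} D∈p
        with b∈bs , b-C ← ∈-filter⁻ touchesC? {xs = bs} b∈ =
        All.lookup (filter-squeeze (λ b → touches? b D) touchesC? (refines D∈p) (C-minimal D∈Ds D-heavy)) b∈bs b-C

      -- `C` is itself heavy and private, so its weight is one summand of `S`.
      X-light : total order X ≤ S
      X-light = ≤-trans C-heavy (member-≤-total weight (∈-filter⁺ (heavy? bs) C∈private C-heavy))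

      -- A private component has all its seers in `X`, so restricting from `bs` to `X` loses none of
      -- them.
      light-light : All (λ D → weight D < total order (seers X D)) light
      light-light = All.tabulate λ {D} D∈ → case ∈-filter⁻ (¬? ∘ heavy? bs) {xs = private′} D∈ of λ where
        (D∈p , ¬heavy) → subst (λ l → weight D < total order l)
          (filter-refine (λ b → touches? b D) touchesC? (refines D∈p)) (≰⇒> ¬heavy)

      heaviest : ∃ λ u → u ∈ X × total (λ b → order b * α b) X ≤ α u * total order X
      heaviest with b , b∈ , b-C ← find (All.lookup covered C∈) =
        weighted-max order α (∈-filter⁺ touchesC? b∈ b-C)

      module Absorber {u} (u∈X : u ∈ X) (u-heaviest : total (λ b → order b * α b) X ≤ α u * total order X) where

        u∈bs : u ∈ bs
        u∈bs = proj₁ (∈-filter⁻ touchesC? {xs = bs} u∈X)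

        u-C : u touches C
        u-C = proj₂ (∈-filter⁻ touchesC? {xs = bs} u∈X)

        eaten : List (List V)
        eaten = filter (touches? u) private′

        module Absorbed (u′ : Branch) (top-u′ : top u′ ≡ top u) (size : excess u′ ≡ excess u + total weight eaten)
          (from : ∀ {x} → x ∈ body u′ → x ∈ body u ⊎ Any (x ∈_) eaten) where

          body-u′ : ∀ {x} → x ∈ body u′ → x ∈ body u ⊎ ∃ λ D → D ∈ private′ × x ∈ D
          body-u′ x∈ with from x∈
          ... | inj₁ x∈u = inj₁ x∈u
          ... | inj₂ x∈Ds with D , D∈ , x∈D ← find x∈Ds =
            inj₂ (D , proj₁ (∈-filter⁻ (touches? u) {xs = private′} D∈) , x∈D)

          excess-u′ : excess u′ ≡ α u + S
          excess-u′ = begin-equality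
            excess u′                                                ≡⟨ size ⟩
            excess u + total weight eaten
              ≡⟨ cong (excess u +_) (total-filter² (touches? u) (heavy? bs) weight private′) ⟩
            excess u + (total weight (filter (touches? u) heavy) + total weight (filter (touches? u) light))
              ≡⟨ cong (λ l → excess u + (total weight l + total weight (filter (touches? u) light)))
                   (filter-all (touches? u) (All.tabulate (heavy-seen u∈X))) ⟩
            excess u + (S + total weight (filter (touches? u) light)) ≡⟨ x∙yz≈xz∙y (excess u) S _ ⟩
            α u + S                                                  ∎

          pronic : Branch → ℕ
          pronic b = excess b * suc (excess b)

          pronicᴰ : List V → ℕ
          pronicᴰ D = weight D * suc (weight D)

          -- With a = `α u`, charging within `X` and the choice of `u` bound `X` and the light
          -- components by a times `total order X`, hence by aS. The heavy ones cost at most S(S+1)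
          -- by superadditivity, and aS + S(S+1) is at most (a+S)(a+S+1).
          local-mass : total pronic X + total pronicᴰ private′ ≤ pronic u′
          local-mass = begin
            total pronic X + total pronicᴰ private′
              ≡⟨ cong (total pronic X +_) (total-filter (heavy? bs) pronicᴰ private′) ⟩
            total pronic X + (total pronicᴰ heavy + total pronicᴰ light)
              ≡⟨ x∙yz≈xz∙y (total pronic X) (total pronicᴰ heavy) _ ⟩
            total pronic X + total pronicᴰ light + total pronicᴰ heavy
              ≤⟨ +-mono-≤ (light-charging X light-light) (total-superadditive weight heavy) ⟩
            total (λ b → order b * α b) X + S * suc S
              ≤⟨ +-monoˡ-≤ (S * suc S) (≤-trans u-heaviest (*-monoʳ-≤ (α u) X-light)) ⟩
            α u * S + S * suc S
              ≤⟨ m≤m+n _ (α u * suc (α u + S)) ⟩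
            α u * S + S * suc S + α u * suc (α u + S)
              ≡⟨ square (α u) S ⟩
            (α u + S) * suc (α u + S)
              ≡⟨ cong (λ p → p * suc p) excess-u′ ⟨
            pronic u′ ∎
            where
            square : ∀ a s → a * s + s * suc s + a * suc (a + s) ≡ (a + s) * suc (a + s)
            square = solve-∀

          mass′ : K * suc K < total pronic (u′ ∷ Y) + total pronicᴰ shared
          mass′ = begin-strict
            K * suc K                                              <⟨ mass ⟩
            total pronic bs + total pronicᴰ Ds
              ≡⟨ cong₂ _+_ (total-filter touchesC? pronic bs) (total-filter shared? pronicᴰ Ds) ⟩
            total pronic X + total pronic Y + (total pronicᴰ shared + total pronicᴰ private′)
              ≡⟨ shuffle (total pronic X) (total pronic Y) (total pronicᴰ shared) (total pronicᴰ private′) ⟩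
            total pronic X + total pronicᴰ private′ + total pronic Y + total pronicᴰ shared
              ≤⟨ +-monoˡ-≤ (total pronicᴰ shared) (+-monoˡ-≤ (total pronic Y) local-mass) ⟩
            pronic u′ + total pronic Y + total pronicᴰ shared ∎
            where
            shuffle : ∀ a b c d → a + b + (c + d) ≡ a + d + b + c
            shuffle = solve-∀

          -- `u` sees `C` and `b` does not, so their bodies were separated before. An edge from an
          -- absorbed component to `b` would end at the top of `b` and make that component shared.
          u′-separated : ∀ {b} → b ∈ Y → Separated (body u′) (body b)
          u′-separated {b} b∈ x∈ y∈ with b∈bs , ¬b-C ← ∈-filter⁻ (¬? ∘ touchesC?) {xs = bs} b∈ with body-u′ x∈
          ... | inj₁ x∈u = AllPairs-cross (_touches C) separated-sym bs-sep u∈bs u-C b∈bs ¬b-C x∈u y∈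
          ... | inj₂ (D , D∈ , x∈D) with D∈Ds , ¬shared ← ∈-filter⁻ (¬? ∘ shared?) {xs = Ds} D∈
            with x≢y , top-only ← All.lookup (All.lookup outside b∈bs) D∈Ds x∈D y∈ =
            x≢y , λ x~y → ¬shared (lose b∈ (lose x∈D (subst (_~ _) (top-only x~y) (~-sym x~y))))

          u′-outside : ∀ {D} → D ∈ shared → Outside u′ D
          u′-outside {D} D∈ x∈ y∈ with D∈Ds , D-shared ← ∈-filter⁻ shared? {xs = Ds} D∈ with body-u′ y∈
          ... | inj₁ y∈u with x≢y , top-only ← All.lookup (All.lookup outside u∈bs) D∈Ds x∈ y∈u =
            x≢y , λ x~y → trans (top-only x~y) (sym top-u′)
          ... | inj₂ (E , E∈ , y∈E) with E∈Ds , ¬E-shared ← ∈-filter⁻ (¬? ∘ shared?) {xs = Ds} E∈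
            with x≢y , x≁y ← AllPairs-cross (λ D → Any (_touches D) Y) separated-sym Ds-sep
              D∈Ds D-shared E∈Ds ¬E-shared x∈ y∈E =
            x≢y , λ x~y → contradiction x~y x≁y

          result : ∃ λ bs′ → ∃ λ Ds′ → length Ds′ < length Ds × State K bs′ Ds′
          result = u′ ∷ Y , shared ,
            -- The list gets strictly shorter because `C` is private.
            filter-notAll shared? Ds (lose C∈ (proj₂ (∈-filter⁻ (¬? ∘ shared?) {xs = Ds} C∈private))) , record
              { blocks = Allₚ.filter⁺ shared? blocks
              ; bs-sep = All.tabulate u′-separated ∷ AllPairsₚ.filter⁺ (¬? ∘ touchesC?) bs-sep
              ; Ds-sep = AllPairsₚ.filter⁺ shared? Ds-sep
              ; outside = All.tabulate u′-outside ∷ Allₚ.filter⁺ (¬? ∘ touchesC?) (All.map (Allₚ.filter⁺ shared?) outside)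
              ; covered = All.map there (Allₚ.all-filter shared? Ds)
              ; mass = mass′
              }

        absorbed : ∃ λ bs′ → ∃ λ Ds′ → length Ds′ < length Ds × State K bs′ Ds′
        absorbed
          with u′ , top-u′ , size , from ← absorb u
            (Allₚ.filter⁺ (touches? u) (Allₚ.filter⁺ (¬? ∘ shared?) blocks))
            (AllPairsₚ.filter⁺ (touches? u) (AllPairsₚ.filter⁺ (¬? ∘ shared?) Ds-sep))
            (Allₚ.filter⁺ (touches? u) (Allₚ.filter⁺ (¬? ∘ shared?) (All.lookup outside u∈bs)))
            (Allₚ.all-filter (touches? u) private′) =
          Absorbed.result u′ top-u′ size from

    absorption : ∃ λ bs′ → ∃ λ Ds′ → length Ds′ < length Ds × State K bs′ Ds′
    absorption with u , u∈X , bound ← heaviest = Absorber.absorbed u∈X bound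

  -- `fuel` bounds the number of components, which each absorption decreases; once no component is
  -- heavy, `no-heavy` finishes.
  harvest : ∀ {K} fuel {bs Ds} → length Ds ≤ fuel → State K bs Ds → Tree v (N ++ W) (2 + K)
  harvest fuel {bs} {Ds} le st with minimal-or-none (heavy? bs) (length ∘ seers bs) Ds
  ... | inj₁ none = no-heavy st none
  harvest zero {Ds = []} le st | inj₂ (_ , () , _)
  harvest (suc fuel) le st | inj₂ (C , C∈ , C-heavy , C-minimal)
    = let bs′ , Ds′ , shorter , st′ = Absorption.absorption st C∈ C-heavy C-minimal
      in harvest fuel (≤-pred (≤-trans shorter le)) st′

-- Connected components of an induced subgraph.

module Components {n : ℕ} (G : Graph n) where
  open Separation G

  Inside : List V → V → V → Set
  Inside L a b = a ∈ L × b ∈ L × a ~ b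

  inside-mono : ∀ {L M} → L ⊆ M → ∀ {x y} → Walk (Inside L) x y → Walk (Inside M) x y
  inside-mono L⊆M = walk-map λ (a , b , e) → L⊆M a , L⊆M b , e

  inside-reverse : ∀ {L x y} → Walk (Inside L) x y → Walk (Inside L) y x
  inside-reverse = walk-reverse λ (a , b , e) → b , a , ~-sym e

  Component : List V → Set
  Component D = ∃ (_∈ D) × (∀ {x y} → x ∈ D → y ∈ D → Walk (Inside D) x y)

  -- Adding a vertex `x` merges exactly the components that `x` sees with `x` and leaves the others
  -- untouched.
  components : ∀ {W} → Unique W → ∃ λ Ds → concat Ds ↭ W × AllPairs Separated Ds × All Component Ds
  components [] = [] , ↭-refl , [] , []
  components {x ∷ W} (x∉ ∷ uniq) with components uniq
  ... | Ds , perm , seps , comps =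
    (x ∷ concat near) ∷ far ,
    prep x (↭-trans (concat-filter-↭ (sees? x) Ds) perm) ,
    All.tabulate far-separated ∷ AllPairsₚ.filter⁺ (¬? ∘ sees? x) seps ,
    ((x , here refl) , λ a b → walk-++ (to-x a) (inside-reverse (to-x b))) ∷ Allₚ.filter⁺ (¬? ∘ sees? x) comps
    where
    near far : List (List V)
    near = filter (sees? x) Ds
    far = filter (¬? ∘ sees? x) Ds
    far-separated : ∀ {E} → E ∈ far → Separated (x ∷ concat near) E
    far-separated E∈ a∈ y∈ with E∈Ds , unseen ← ∈-filter⁻ (¬? ∘ sees? x) {xs = Ds} E∈ with a∈
    ... | here refl = All.lookup x∉ (Permₚ.∈-resp-↭ perm (∈-concat⁺′ y∈ E∈Ds)) , λ e → unseen (lose y∈ e)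
    ... | there a∈near with D , a∈D , D∈ ← ∈-concat⁻′ near a∈near
      with D∈Ds , seen ← ∈-filter⁻ (sees? x) {xs = Ds} D∈ =
      AllPairs-cross (Sees x) separated-sym seps D∈Ds seen E∈Ds unseen a∈D y∈
    to-x : ∀ {z} → z ∈ x ∷ concat near → Walk (Inside (x ∷ concat near)) z x
    to-x (here refl) = here
    to-x (there z∈) with D , z∈D , D∈ ← ∈-concat⁻′ near z∈
      with D∈Ds , seen ← ∈-filter⁻ (sees? x) {xs = Ds} D∈ with a , a∈D , x~a ← find seen =
      walk-++ (inside-mono (λ y∈ → there (∈-concat⁺′ y∈ D∈)) (proj₂ (All.lookup comps D∈Ds) z∈D a∈D))
        (step (there (∈-concat⁺′ a∈D D∈) , here refl , ~-sym x~a) here)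

-- Induction on the number of vertices.

module Induction {n : ℕ} (G : Graph n) (triangle-free : TriangleFree G) where
  open Separation G
  open Components G

  open DecMembership {A = V} _≟_ using (_∈?_)

  tree-mono : ∀ {r C D s} → C ⊆ D → Tree r C s → Tree r D s
  tree-mono C⊆D (L , g , len , scope) = L , g , len , Sum.map₂ C⊆D ∘ scope

  -- The induction statement: more than s(s+1)/2 vertices besides the root force a tree with s + 1
  -- vertices besides the root. The bound `m` on the length of `C` is the induction variable.
  LargeTrees : ℕ → Set
  LargeTrees m = ∀ {r C s} → length C ≤ m → Unique C → r ∉ C → (∀ {x} → x ∈ C → Walk (Inside (r ∷ C)) x r) →
    s * suc s < 2 * length C → Tree r C (suc s)

  independent : ∀ {v x y} → v ~ x → v ~ y → ¬ x ~ y
  independent v~x v~y x~y = triangle-free _ _ _ v~x x~y v~y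

  -- Neighbours of `r` are independent by triangle-freeness, so each one attaches as a leaf at `r`.
  star : ∀ {r us} → All (r ~_) us → Unique us → Tree r us (length us)
  star [] [] = _ , root , refl , λ { (here eq) → inj₁ eq ; (there ()) }
  star {r} {u ∷ us} (r~u ∷ near) (u∉ ∷ uniq) with star near uniq
  ... | L , g , len , scope = u ∷ L , leaf g (root∈ g) (~-sym r~u) only-root fresh , cong suc len , scope′
    where
    only-root : ∀ {z} → z ∈ L → u ~ z → z ≡ r
    only-root z∈ u~z with scope z∈
    ... | inj₁ z≡r = z≡r
    ... | inj₂ z∈us = contradiction u~z (independent r~u (All.lookup near z∈us))
    fresh : u ∉ L
    fresh u∈ with scope u∈
    ... | inj₁ u≡r = ~⇒≢ r~u (sym u≡r)
    ... | inj₂ u∈us = All.lookup u∉ u∈us refl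
    scope′ : ∀ {z} → z ∈ u ∷ L → z ≡ r ⊎ z ∈ u ∷ us
    scope′ (here refl) = inj₂ (here refl)
    scope′ (there z∈) = Sum.map₂ there (scope z∈)

  weight : List V → ℕ
  weight D = proj₁ (triangularRoot (length D))

  module Assembly {m} (large : LargeTrees m) {v N W}
    (N-near : ∀ {u} → u ∈ N → v ~ u) (W-far : ∀ {x} → x ∈ W → x ≢ v × ¬ v ~ x)
    (N-unique : Unique N) (W-unique : Unique W)
    (connected : ∀ {x} → x ∈ W → Walk (Inside (v ∷ N ++ W)) x v)
    (small : length N + length W ≤ suc m) where
    open Gathering G v N W N-near W-far weight
    open Branch

    -- The initial one-vertex branches; they are separated because neighbours of `v` are
    -- independent.
    sprouts : ∀ {us} → us ⊆ N → Unique us → ∃ λ bs → AllPairs (λ b b′ → Separated (body b) (body b′)) bs ×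
      All (λ b → top b ∈ us × body b ≡ top b ∷ []) bs × (∀ {u} → u ∈ us → Any (λ b → top b ≡ u) bs)
    sprouts {[]} _ [] = [] , [] , [] , λ ()
    sprouts {u ∷ us} us⊆N (u∉ ∷ uniq) with sprouts (us⊆N ∘ there) uniq
    ... | bs , seps , singletons , tops =
      b ∷ bs , All.map (λ {b′} s {_} {_} → separated {b′} s) singletons ∷ seps ,
      (here refl , refl) ∷ All.map (λ (t∈ , eq) → there t∈ , eq) singletons ,
      λ { (here refl) → here refl ; (there u∈) → there (tops u∈) }
      where
      b : Branch
      b = record
        { top = u ; top∈ = us⊆N (here refl) ; body = u ∷ [] ; grown = root
        ; excess = 0 ; length-body = refl ; scope = λ { (here eq) → inj₁ eq ; (there ()) } }
      separated : ∀ {b′} → top b′ ∈ us × body b′ ≡ top b′ ∷ [] → Separated (u ∷ []) (body b′)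
      separated (t∈ , single) (here refl) y∈ with subst (_ ∈_) single y∈
      ... | here refl =
        All.lookup u∉ t∈ , independent (N-near (us⊆N (here refl))) (N-near (us⊆N (there t∈)))

    block : ∀ {D} → D ⊆ W → Unique D → Component D → length D ≤ length W → Block D
    block {D} D⊆W D-unique (_ , walks) D≤W =
      D⊆W , λ u∈ seen → build u∈ seen _ (proj₂ (proj₂ (triangularRoot (length D))))
      where
      build : ∀ {u} → u ∈ N → Sees u D → ∀ s → (∀ {r} → s ≡ suc r → r * suc r < 2 * length D) → Tree u D s
      build {u} _ _ zero _ = u ∷ [] , root , refl , λ { (here eq) → inj₁ eq ; (there ()) }
      build {u} u∈ seen (suc s) bound with a , a∈D , u~a ← find seen =
        -- `N` contains `u`, so `W`, and with it `D`, has at most `m` vertices and the induction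
        -- hypothesis applies.
        large (≤-pred (≤-trans (+-mono-≤ (∈-length u∈) D≤W) small)) D-unique (λ u∈D → near≢far u∈ (D⊆W u∈D) refl)
          (λ x∈ → walk-++ (inside-mono there (walks x∈ a∈D)) (step (there a∈D , here refl , ~-sym u~a) here))
          (bound refl)

    tree : ∀ {K} → K * suc K < 2 * length W → Tree v (N ++ W) (2 + K)
    tree {K} many with components W-unique | sprouts (λ u∈ → u∈) N-unique
    ... | Ds , perm , seps , comps | bs , bs-seps , singletons , tops =
      harvest (length Ds) ≤-refl record
        { blocks = All.tabulate λ D∈ → block (D⊆W D∈) (All.lookup uniques D∈) (All.lookup comps D∈) (D≤W D∈)
        ; bs-sep = bs-seps
        ; Ds-sep = seps
        ; outside = All.map (λ {b} (_ , single) → All.tabulate (λ {D} D∈ {_} {_} → outside {b} D∈ single)) singletons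
        ; covered = All.tabulate covered
        -- The components already carry enough mass: twice the size of each is at most its summand,
        -- and the sizes add up to that of `W`.
        ; mass = <-≤-trans many (≤-trans (≤-trans (≤-reflexive (cong (2 *_) (sym (Permₚ.↭-length perm))))
            (length-concat-bound (All.universal (λ D → proj₁ (proj₂ (triangularRoot (length D)))) Ds)))
            (m≤n+m _ (total (λ b → excess b * suc (excess b)) bs)))
        }
      where
      D⊆W : ∀ {D} → D ∈ Ds → D ⊆ W
      D⊆W D∈ x∈ = Permₚ.∈-resp-↭ perm (∈-concat⁺′ x∈ D∈)
      uniques : All Unique Ds
      uniques = AllPairs-concat⁻ Ds (PermSetoidₚ.Unique-resp-↭ (setoid _) (↭⇒↭ₛ (↭-sym perm)) W-unique)
      D≤W : ∀ {D} → D ∈ Ds → length D ≤ length W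
      D≤W D∈ = ≤-trans (length-≤-concat D∈) (≤-reflexive (Permₚ.↭-length perm))
      outside : ∀ {b D} → D ∈ Ds → body b ≡ top b ∷ [] → Outside b D
      outside {b} D∈ single x∈ y∈ with subst (_ ∈_) single y∈
      ... | here refl = near≢far (top∈ b) (D⊆W D∈ x∈) , λ _ → refl
      -- A walk from `D` to `v` leaves `D` along an edge whose far end is neither `v` nor in another
      -- component, so it lies in `N`.
      covered : ∀ {D} → D ∈ Ds → Any (_touches D) bs
      covered {D} D∈ with All.lookup comps D∈
      ... | (x , x∈) , _
        with a , b , a∈D , b∉D , (_ , b∈ , a~b) ←
          walk-exit (λ z → z ∈? D) (connected (D⊆W D∈ x∈)) x∈ (λ v∈ → proj₁ (W-far (D⊆W D∈ v∈)) refl)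
        with b∈
      ... | here refl = contradiction (~-sym a~b) (proj₂ (W-far (D⊆W D∈ a∈D)))
      ... | there b∈NW with ∈-++⁻ N b∈NW
      ... | inj₁ b∈N = Any.map (λ { refl → lose a∈D (~-sym a~b) }) (tops b∈N)
      ... | inj₂ b∈W with E , b∈E , E∈ ← ∈-concat⁻′ Ds (Permₚ.∈-resp-↭ (↭-sym perm) b∈W)
        with AllPairs-lookup separated-sym seps D∈ E∈
      ... | inj₁ refl = contradiction b∈E b∉D
      ... | inj₂ sep = contradiction a~b (proj₂ (sep a∈D b∈E))

  -- With at least s + 1 neighbours in `C` the star at `r` suffices. Otherwise deleting at most s
  -- neighbours keeps the doubled count above s(s+1) - 2s = (s-1)s, which is what the assembly needs
  -- for K = s - 1.
  large-trees : ∀ m → LargeTrees m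
  large-trees zero {C = []} _ _ _ _ ()
  large-trees (suc m) {r} {C} {s} C≤m C-unique r∉C connected many with suc s ≤? length (filter (r ~?_) C)
  ... | yes big = tree-mono (proj₁ ∘ ∈-filter⁻ (r ~?_))
    (shrink big (star (Allₚ.all-filter (r ~?_) C) (Uniqueₚ.filter⁺ (r ~?_) C-unique)))
  ... | no few = tree-mono NW⊆C (descend s (≤-pred (≰⇒> few)) (subst (s * suc s <_) split many))
    where
    near? : ∀ x → Dec (r ~ x)
    near? = r ~?_
    N W : List V
    N = filter near? C
    W = filter (¬? ∘ near?) C
    split : 2 * length C ≡ 2 * length N + 2 * length W
    split = trans (cong (2 *_) (sym (length-filter-complement near? C))) (*-distribˡ-+ 2 (length N) (length W))
    NW⊆C : N ++ W ⊆ C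
    NW⊆C x∈ with ∈-++⁻ N x∈
    ... | inj₁ x∈N = proj₁ (∈-filter⁻ near? x∈N)
    ... | inj₂ x∈W = proj₁ (∈-filter⁻ (¬? ∘ near?) x∈W)
    C⊆NW : r ∷ C ⊆ r ∷ N ++ W
    C⊆NW (here eq) = here eq
    C⊆NW {x} (there x∈) with near? x
    ... | yes r~x = there (∈-++⁺ˡ (∈-filter⁺ near? x∈ r~x))
    ... | no r≁x = there (∈-++⁺ʳ N (∈-filter⁺ (¬? ∘ near?) x∈ r≁x))
    assemble : ∀ {K} → K * suc K < 2 * length W → Tree r (N ++ W) (2 + K)
    assemble = Assembly.tree (large-trees m) (proj₂ ∘ ∈-filter⁻ near? {xs = C})
      (λ x∈ → case ∈-filter⁻ (¬? ∘ near?) {xs = C} x∈ of λ (x∈C , r≁x) → (λ { refl → r∉C x∈C }) , r≁x)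
      (Uniqueₚ.filter⁺ near? C-unique) (Uniqueₚ.filter⁺ (¬? ∘ near?) C-unique)
      (λ x∈ → inside-mono C⊆NW (connected (proj₁ (∈-filter⁻ (¬? ∘ near?) x∈))))
      (≤-trans (≤-reflexive (length-filter-complement near? C)) C≤m)
    descend : ∀ s → length N ≤ s → s * suc s < 2 * length N + 2 * length W → Tree r (N ++ W) (suc s)
    -- For s = 0 there is no K = s - 1; K = 0 is used instead, and its tree is one vertex too large.
    descend zero N≤0 bound = prune (assemble (<-≤-trans bound (+-monoˡ-≤ (2 * length W) (*-monoʳ-≤ 2 N≤0))))
    descend (suc K) N≤s bound = assemble (+-cancelˡ-< (2 * suc K) _ _ (begin-strict
      2 * suc K + K * suc K          ≡⟨ pronic-suc K ⟩
      suc K * suc (suc K)            <⟨ bound ⟩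
      2 * length N + 2 * length W    ≤⟨ +-monoˡ-≤ (2 * length W) (*-monoʳ-≤ 2 N≤s) ⟩
      2 * suc K + 2 * length W       ∎))
      where
      open ≤-Reasoning
      pronic-suc : ∀ K → 2 * suc K + K * suc K ≡ suc K * suc (suc K)
      pronic-suc = solve-∀

-- From too many non-neighbours of v to a forbidden tree.

theorem2 : (k : ℕ) → 1 ≤ k → {n : ℕ} → (G : Graph n) → Connected G → TriangleFree G →
    (v : Fin n) →
    ((S : Subset n) → ∣ S ∣ ≡ suc k → v ∈ₛ S → InducedTree G S → ⊥) →
    2 * ∣ nonNeighbourhood G v ∣ ≤ (k ∸ 2) * (k ∸ 1)
theorem2 k 1≤k {n} G connected triangle-free v no-tree = 
  ≮⇒≥ (λ many → refute (sized k 1≤k (subst (λ l → (k ∸ 2) * (k ∸ 1) < 2 * l) size many)))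
  where
  open Separation G
  open Components G
  open Induction G triangle-free

  near? : ∀ x → Dec (v ~ x)
  near? = v ~?_

  -- Repeats the predicate inside `nonNeighbourhood` verbatim, so that `size` is an instance of
  -- `length-tabulate-filter`.
  isFar : V → Bool
  isFar u = not (⌊ u ≟ v ⌋ ∨ adj G v u)

  N W : List V
  N = filter near? (allFin n)
  W = filter (T? ∘ isFar) (allFin n)

  size : ∣ nonNeighbourhood G v ∣ ≡ length W
  size = length-tabulate-filter isFar (λ u → u)

  far⇒ : ∀ {x} → T (isFar x) → x ≢ v × ¬ v ~ x
  far⇒ {x} t with x ≟ v | adj G v x
  ... | no x≢v | false = x≢v , λ ()

  everywhere : ∀ {x} → x ∈ v ∷ N ++ W
  everywhere {x} with x ≟ v in x≟v | adj G v x in v~x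
  ... | yes x≡v | _ = here x≡v
  ... | no _ | true = there (∈-++⁺ˡ (∈-filter⁺ near? (∈-allFin x) (subst T (sym v~x) _)))
  ... | no _ | false = there (∈-++⁺ʳ N (∈-filter⁺ (T? ∘ isFar) (∈-allFin x)
    (subst T (sym (cong₂ (λ d a → not (⌊ d ⌋ ∨ a)) x≟v v~x)) _)))

  tree : ∀ {K} → K * suc K < 2 * length W → Tree v (N ++ W) (2 + K)
  tree = Assembly.tree (large-trees (length N + length W)) (proj₂ ∘ ∈-filter⁻ near? {xs = allFin n})
    (λ x∈ → far⇒ (proj₂ (∈-filter⁻ (T? ∘ isFar) {xs = allFin n} x∈)))
    (Uniqueₚ.filter⁺ near? (Uniqueₚ.allFin⁺ n)) (Uniqueₚ.filter⁺ _ (Uniqueₚ.allFin⁺ n))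
    (λ {x} _ → walk-map (λ e → everywhere , everywhere , e) (connected x v)) (n≤1+n _)

  sized : ∀ k → 1 ≤ k → (k ∸ 2) * (k ∸ 1) < 2 * length W → Tree v (N ++ W) k
  -- For k = 1 both truncated differences are 0, so K = 0 applies and gives one vertex more than
  -- required.
  sized (suc zero) _ many = prune (tree {0} many)
  sized (suc (suc K)) _ many = tree many

  refute : Tree v (N ++ W) k → ⊥
  refute (L , g , len , _) =
    no-tree (toSubset L) (trans (∣toSubset∣ g) len) (toSubset⁺ (root∈ g)) (inducedTree g)
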